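{- There exist $0/1$ matrices $M$ with $\mathrm{fool}(M)\ge \mathrm{rank}(M)^{2-o(1)}$; precisely, there exist square $0/1$ matrices $M_1,M_2,\dots$ with $\mathrm{rank}(M_t)\to\infty$ and a function $\varepsilon$ with $\varepsilon(t)\to 0$ as $t\to\infty$ such that $\mathrm{fool}(M_t)\ge \mathrm{rank}(M_t)^{2-\varepsilon(t)}$ for all $t$.
   Context: For an $n\times n$ $0/1$ matrix $M$, $\mathrm{rank}(M)$ is its rank over the reals. A set $S\subseteq[n]\times[n]$ is a fooling set for $M$ if there is $z\in\{0,1\}$ such that (1) $M_{k,\ell}=z$ for every $(k,\ell)\in S$, and (2) for any distinct $(k_1,\ell_1),(k_2,\ell_2)\in S$, $M_{k_1,\ell_2}\ne z$ or $M_{k_2,\ell_1}\ne z$. $\mathrm{fool}(M)$ is the largest size of a fooling set for $M$. -}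

module Defs where

open import Data.Nat using (ℕ; zero; suc; _≤_; _^_) renaming (_*_ to _*ℕ_)
open import Data.Integer using (ℤ; +_; -[1+_])
open import Data.Rational using (ℚ; 0ℚ; 1ℚ; _+_; _*_; _-_; _<_; ∣_∣; ↥_; ↧ₙ_)
open import Data.Fin using (Fin; zero; suc)
open import Data.Bool using (Bool; true; false)
open import Data.Product using (_×_; _,_; Σ; ∃; proj₁; proj₂)
open import Data.Sum using (_⊎_)
open import Function.Definitions using (Injective)
open import Relation.Binary.PropositionalEquality using (_≡_; _≢_)

Matrix : ℕ → Set
Matrix n = Fin n → Fin n → Bool

toℚ : Bool → ℚ
toℚ false = 0ℚ
toℚ true  = 1ℚ

sumℚ : (k : ℕ) → (Fin k → ℚ) → ℚ
sumℚ zero    f = 0ℚ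
sumℚ (suc k) f = f zero + sumℚ k (λ i → f (suc i))

RowsIndependent : ∀ {n k} → Matrix n → (Fin k → Fin n) → Set
RowsIndependent {n} {k} M ρ =
  (c : Fin k → ℚ) →
  ((j : Fin n) → sumℚ k (λ i → c i * toℚ (M (ρ i) j)) ≡ 0ℚ) →
  (i : Fin k) → c i ≡ 0ℚ

-- r is the rank of M over ℚ (= rank over ℝ for a 0/1 matrix):
-- the maximal number of linearly independent rows.
IsRank : ∀ {n} → Matrix n → ℕ → Set
IsRank {n} M r =
  (Σ (Fin r → Fin n) λ ρ → RowsIndependent M ρ) ×
  (∀ k (ρ : Fin k → Fin n) → RowsIndependent M ρ → k ≤ r)

IsFoolingSet : ∀ {n k} → Matrix n → (Fin k → Fin n × Fin n) → Set
IsFoolingSet {n} {k} M s =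
  Injective _≡_ _≡_ s ×
  Σ Bool λ z →
    ((i : Fin k) → M (proj₁ (s i)) (proj₂ (s i)) ≡ z) ×
    ((i j : Fin k) → i ≢ j →
       (M (proj₁ (s i)) (proj₂ (s j)) ≢ z) ⊎ (M (proj₁ (s j)) (proj₂ (s i)) ≢ z))

IsFool : ∀ {n} → Matrix n → ℕ → Set
IsFool {n} M f =
  (Σ (Fin f → Fin n × Fin n) λ s → IsFoolingSet M s) ×
  (∀ k (s : Fin k → Fin n × Fin n) → IsFoolingSet M s → k ≤ f)

-- PowLe r e f  means  r ^ e ≤ f  for a natural r and rational exponent e = a/b (b > 0):
--   a ≥ 0 :  r ^ a ≤ f ^ b
--   a < 0 :  1 ≤ f ^ b * r ^ |a|   (false when r = 0, where r^e = ∞)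
PowLe : ℕ → ℚ → ℕ → Set
PowLe r e f with ↥ e
... | + a      = r ^ a ≤ f ^ (↧ₙ e)
... | -[1+ a ] = 1 ≤ (f ^ (↧ₙ e)) *ℕ (r ^ suc a)

TendsToInfinity : (ℕ → ℕ) → Set
TendsToInfinity a = ∀ B → ∃ λ T → ∀ t → T ≤ t → B ≤ a t

TendsToZero : (ℕ → ℚ) → Set
TendsToZero ε = ∀ δ → 0ℚ < δ → ∃ λ T → ∀ t → T ≤ t → ∣ ε t ∣ < δ

2ℚ : ℚ
2ℚ = 1ℚ + 1ℚ

{-# OPTIONS --safe #-}
module Submission where

-- For words u = (a, b, c) and v = (a′, b′, c′), where a and b are letters of an
-- alphabet of size m and c is again a word, put recursively
--   G(u, v) = [a ≤ a′][b = b′] G(c, c′) + [a > a′][b ≠ b′] (1 − G(c, c′)),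
-- starting from G = equality on single letters.  Then G(u, u) = 1, while
-- G(u, v) = G(v, u) = 1 forces u = v (if a ≠ a′, the two orders demand both b = b′
-- and b ≠ b′), so the whole diagonal is a fooling set of size m^(2k+1).
-- Writing A, B, C for the three bits [a ≤ a′], [b = b′], G(c, c′),
--   G = B C − (1 − A) C + (1 − A)(1 − B),
-- so the rank satisfies R_{k+1} ≤ 2 m R_k + m² and R_k ≤ 3^k m^(k+1).
-- Taking m = 3^k makes the factor 3^k negligible in the exponent.

open import Defs
open import Data.Nat using (ℕ)
open import Data.Rational using (ℚ; _-_)
open import Data.Product using (Σ; _×_)

open import Data.Nat as ℕ using (zero; suc; _≤_; z≤n; s≤s)
import Data.Nat.Properties as ℕ
open import Data.Nat.Coprimality using (Coprime; 1-coprimeTo)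
open import Data.Nat.Divisibility using (_∣_; ∣m+n∣m⇒∣n; ∣n⇒∣m*n; ∣1⇒≡1)
import Data.Nat.Solver as ℕSolver
import Data.Integer as ℤ
open import Data.Rational using (mkℚ; 0ℚ; 1ℚ; _+_; _*_; -_; 1/_; *<*; ≢-nonZero)
open import Data.Rational.Properties using (_≟_; +-identityˡ; +-identityʳ; +-assoc; *-assoc; *-distribʳ-+; *-identityʳ; *-identityˡ; *-zeroˡ; *-zeroʳ; *-inverseˡ; *-inverseʳ; toℚᵘ-homo-+; toℚᵘ-injective)
open import Data.Rational.Solver using (module +-*-Solver)
open import Data.Rational.Unnormalised using (*≡*)
import Data.Rational.Unnormalised.Properties as ℚᵘ
open import Data.Fin as Fin using (Fin; zero; suc; punchIn; combine)
open import Data.Fin.Properties using (any?; all?; ¬∀⟶∃¬; injective⇒≤; combine-injective; punchIn-punchOut; punchInᵢ≢i; *↔×) renaming (_≟_ to _≟F_; _≤?_ to _≤?F_; ≤-antisym to ≤F-antisym; ≤-total to ≤F-total; ≤-refl to ≤F-refl)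
open import Data.Vec.Functional using (_∷_; insertAt)
open import Data.Vec.Functional.Properties using (insertAt-lookup; insertAt-punchIn)
open import Data.Bool using (Bool; true; false; _∧_; not; if_then_else_)
open import Data.Bool.Properties using () renaming (_≟_ to _≟B_)
open import Data.Product using (_,_; ∃; proj₁; proj₂)
open import Data.Product.Properties using (≡-dec)
open import Data.Product.Function.NonDependent.Propositional using (_×-↔_)
open import Data.Sum using (_⊎_; inj₁; inj₂)
open import Function using (_∘_; _↔_; Inverse)
open import Function.Properties.Inverse using (↔-refl; ↔-trans)
open import Relation.Binary.PropositionalEquality
open import Relation.Nullary using (Dec; yes; no; does; ¬_; contradiction; _×-dec_; _⊎-dec_; _→-dec_; ¬?)
open import Relation.Nullary.Decidable using (map′; dec-true; dec-false)
open import Relation.Unary using (Decidable)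

-- Finite sums

sumℚ-cong : ∀ {k} {f g : Fin k → ℚ} → f ≗ g → sumℚ k f ≡ sumℚ k g
sumℚ-cong {zero}  f≗g = refl
sumℚ-cong {suc k} f≗g = cong₂ _+_ (f≗g zero) (sumℚ-cong (f≗g ∘ suc))

sumℚ-zero : ∀ {k} {f : Fin k → ℚ} → (∀ i → f i ≡ 0ℚ) → sumℚ k f ≡ 0ℚ
sumℚ-zero {zero}  f≗0 = refl
sumℚ-zero {suc k} f≗0 = cong₂ _+_ (f≗0 zero) (sumℚ-zero (f≗0 ∘ suc))

sumℚ-+ : ∀ {k} (f g : Fin k → ℚ) → sumℚ k (λ i → f i + g i) ≡ sumℚ k f + sumℚ k g
sumℚ-+ {zero}  f g = refl
sumℚ-+ {suc k} f g = trans (cong (f zero + g zero +_) (sumℚ-+ (f ∘ suc) (g ∘ suc)))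
  (solve 4 (λ a b s t → (a :+ b) :+ (s :+ t) := (a :+ s) :+ (b :+ t)) refl
    (f zero) (g zero) (sumℚ k (f ∘ suc)) (sumℚ k (g ∘ suc)))
  where open +-*-Solver

sumℚ-* : ∀ {k} (f : Fin k → ℚ) a → sumℚ k (λ i → f i * a) ≡ sumℚ k f * a
sumℚ-* {zero}  f a = sym (*-zeroˡ a)
sumℚ-* {suc k} f a = trans (cong (f zero * a +_) (sumℚ-* (f ∘ suc) a))
  (sym (*-distribʳ-+ a (f zero) (sumℚ k (f ∘ suc))))

sumℚ-punchIn : ∀ {k} (f : Fin (suc k) → ℚ) i → sumℚ (suc k) f ≡ f i + sumℚ k (f ∘ punchIn i)
sumℚ-punchIn         f zero    = refl
sumℚ-punchIn {suc k} f (suc i) = trans (cong (f zero +_) (sumℚ-punchIn (f ∘ suc) i))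
  (solve 3 (λ a b s → a :+ (b :+ s) := b :+ (a :+ s)) refl
    (f zero) (f (suc i)) (sumℚ k (f ∘ suc ∘ punchIn i)))
  where open +-*-Solver

-- Gaussian elimination

-- Rational entries are allowed because elimination leaves the 0/1 matrices. On the rows of such a
-- matrix this unfolds to `RowsIndependent`.
Independent : ∀ {k n} → (Fin k → Fin n → ℚ) → Set
Independent {k} w = ∀ (c : Fin k → ℚ) → (∀ j → sumℚ k (λ i → c i * w i j) ≡ 0ℚ) → ∀ i → c i ≡ 0ℚ

-- One elimination step: row `p` clears column `zero` and is then dropped together with that column.
module Pivot {k n} (w : Fin (suc k) → Fin (suc n) → ℚ) (p : Fin (suc k)) (pivot≢0 : w p zero ≢ 0ℚ) where

  private instance
    pivot-nonZero = ≢-nonZero pivot≢0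

  pivot : ℚ
  pivot = w p zero

  ratio : Fin k → ℚ
  ratio i = w (punchIn p i) zero * 1/ pivot

  reduced : Fin k → Fin n → ℚ
  reduced i j = w (punchIn p i) (suc j) - ratio i * w p (suc j)

  -- The only coefficient of row `p` that can cancel column `zero` against the other rows.
  pivotCoeff : (Fin k → ℚ) → ℚ
  pivotCoeff c = - sumℚ k (λ i → c i * ratio i)

  pivotColumn : ∀ c → sumℚ k (λ i → c i * w (punchIn p i) zero) ≡ - pivotCoeff c * pivot
  pivotColumn c = begin
    sumℚ k (λ i → c i * w (punchIn p i) zero)  ≡⟨ sumℚ-cong (λ i → cancel (c i) (w (punchIn p i) zero)) ⟩
    sumℚ k (λ i → c i * ratio i * pivot)       ≡⟨ sumℚ-* (λ i → c i * ratio i) pivot ⟩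
    sumℚ k (λ i → c i * ratio i) * pivot       ≡⟨ solve 2 (λ s a → s :* a := (:- (:- s)) :* a) refl (sumℚ k (λ i → c i * ratio i)) pivot ⟩
    - pivotCoeff c * pivot                     ∎
    where
    open ≡-Reasoning
    open +-*-Solver
    cancel : ∀ x y → x * y ≡ x * (y * 1/ pivot) * pivot
    cancel x y = begin
      x * y                       ≡⟨ *-identityʳ (x * y) ⟨
      x * y * 1ℚ                  ≡⟨ cong (x * y *_) (*-inverseˡ pivot) ⟨
      x * y * (1/ pivot * pivot)  ≡⟨ solve 4 (λ x y u v → x :* y :* (u :* v) := x :* (y :* u) :* v) refl x y (1/ pivot) pivot ⟩
      x * (y * 1/ pivot) * pivot  ∎

  otherColumn : ∀ c j → pivotCoeff c * w p (suc j) + sumℚ k (λ i → c i * w (punchIn p i) (suc j))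
                        ≡ sumℚ k (λ i → c i * reduced i j)
  otherColumn c j = sym (begin
    sumℚ k (λ i → c i * reduced i j)
      ≡⟨ sumℚ-cong (λ i → solve 4 (λ c v r b → c :* (v :- r :* b) := c :* v :+ c :* r :* (:- b)) refl (c i) (w (punchIn p i) (suc j)) (ratio i) b) ⟩
    sumℚ k (λ i → c i * w (punchIn p i) (suc j) + c i * ratio i * (- b))
      ≡⟨ sumℚ-+ (λ i → c i * w (punchIn p i) (suc j)) (λ i → c i * ratio i * (- b)) ⟩
    s + sumℚ k (λ i → c i * ratio i * (- b))
      ≡⟨ cong (s +_) (sumℚ-* (λ i → c i * ratio i) (- b)) ⟩
    s + sumℚ k (λ i → c i * ratio i) * (- b)
      ≡⟨ solve 3 (λ s t b → s :+ t :* (:- b) := (:- t) :* b :+ s) refl s (sumℚ k (λ i → c i * ratio i)) b ⟩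
    pivotCoeff c * b + s ∎)
    where
    open ≡-Reasoning
    open +-*-Solver
    b = w p (suc j)
    s = sumℚ k (λ i → c i * w (punchIn p i) (suc j))

  -- Column `zero` of a relation forces the coefficient at `p` to be `pivotCoeff` of the others; the
  -- remaining columns are then a relation among the reduced rows.
  reduced⇒full : Independent reduced → Independent w
  reduced⇒full indep c cw≡0 = c≡0
    where
    open ≡-Reasoning
    open +-*-Solver
    c′ = c ∘ punchIn p
    split : ∀ j → c p * w p j + sumℚ k (λ i → c′ i * w (punchIn p i) j) ≡ 0ℚ
    split j = trans (sym (sumℚ-punchIn (λ i → c i * w i j) p)) (cw≡0 j)
    difference*pivot : (c p - pivotCoeff c′) * pivot ≡ 0ℚ
    difference*pivot = begin
      (c p - pivotCoeff c′) * pivot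
        ≡⟨ solve 3 (λ x y a → (x :- y) :* a := x :* a :+ (:- y) :* a) refl (c p) (pivotCoeff c′) pivot ⟩
      c p * pivot + - pivotCoeff c′ * pivot
        ≡⟨ cong (c p * pivot +_) (pivotColumn c′) ⟨
      c p * pivot + sumℚ k (λ i → c′ i * w (punchIn p i) zero)
        ≡⟨ split zero ⟩
      0ℚ ∎
    d : ℚ
    d = c p - pivotCoeff c′
    d≡0 : d ≡ 0ℚ
    d≡0 = begin
      d                       ≡⟨ *-identityʳ d ⟨
      d * 1ℚ                  ≡⟨ cong (d *_) (*-inverseʳ pivot) ⟨
      d * (pivot * 1/ pivot)  ≡⟨ *-assoc d pivot (1/ pivot) ⟨
      d * pivot * 1/ pivot    ≡⟨ cong (_* 1/ pivot) difference*pivot ⟩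
      0ℚ * 1/ pivot           ≡⟨ *-zeroˡ (1/ pivot) ⟩
      0ℚ                      ∎
    cp≡ : c p ≡ pivotCoeff c′
    cp≡ = begin
      c p                 ≡⟨ solve 2 (λ x y → x := x :- y :+ y) refl (c p) (pivotCoeff c′) ⟩
      d + pivotCoeff c′   ≡⟨ cong (_+ pivotCoeff c′) d≡0 ⟩
      0ℚ + pivotCoeff c′  ≡⟨ +-identityˡ (pivotCoeff c′) ⟩
      pivotCoeff c′       ∎
    c′≡0 : ∀ i → c′ i ≡ 0ℚ
    c′≡0 = indep c′ λ j → trans (sym (otherColumn c′ j))
      (trans (cong (λ x → x * w p (suc j) + sumℚ k (λ i → c′ i * w (punchIn p i) (suc j))) (sym cp≡)) (split (suc j)))
    cp≡0 : c p ≡ 0ℚ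
    cp≡0 = trans cp≡ (cong -_ (sumℚ-zero λ i → trans (cong (_* ratio i) (c′≡0 i)) (*-zeroˡ (ratio i))))
    c≡0 : ∀ i → c i ≡ 0ℚ
    c≡0 i with p ≟F i
    ... | yes refl = cp≡0
    ... | no  p≢i  = subst (λ i → c i ≡ 0ℚ) (punchIn-punchOut p≢i) (c′≡0 (Fin.punchOut p≢i))

  -- A relation among the reduced rows lifts: inserting `pivotCoeff` at `p` kills column `zero`, and
  -- `otherColumn` handles the other columns.
  full⇒reduced : Independent w → Independent reduced
  full⇒reduced indep c′ c′w≡0 i = trans (sym (at-punchIn i)) (indep c cw≡0 (punchIn p i))
    where
    open ≡-Reasoning
    c : Fin (suc k) → ℚ
    c = insertAt c′ p (pivotCoeff c′)
    at-punchIn : ∀ i → c (punchIn p i) ≡ c′ i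
    at-punchIn = insertAt-punchIn c′ p (pivotCoeff c′)
    split : ∀ j → sumℚ (suc k) (λ i → c i * w i j) ≡ pivotCoeff c′ * w p j + sumℚ k (λ i → c′ i * w (punchIn p i) j)
    split j = trans (sumℚ-punchIn (λ i → c i * w i j) p)
      (cong₂ _+_ (cong (_* w p j) (insertAt-lookup c′ p (pivotCoeff c′)))
                 (sumℚ-cong λ i → cong (_* w (punchIn p i) j) (at-punchIn i)))
    cw≡0 : ∀ j → sumℚ (suc k) (λ i → c i * w i j) ≡ 0ℚ
    cw≡0 zero    = trans (split zero) (trans (cong (pivotCoeff c′ * pivot +_) (pivotColumn c′))
      (solve 2 (λ x a → x :* a :+ (:- x) :* a := con 0ℚ) refl (pivotCoeff c′) pivot))
      where open +-*-Solver
    cw≡0 (suc j) = trans (split (suc j)) (trans (otherColumn c′ j) (c′w≡0 j))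

-- Elimination column by column. Every pivot uses up one row and one column, so the dimension bound
-- k ≤ n comes out of the same recursion.
independent? : ∀ {k n} (w : Fin k → Fin n → ℚ) → (Independent w × k ≤ n) ⊎ ¬ Independent w
independent? {zero}          w = inj₁ ((λ _ _ ()) , z≤n)
-- Without columns every combination is a relation, so coefficients 1 refute independence.
independent? {suc k} {zero}  w = inj₂ λ indep → contradiction (indep (λ _ → 1ℚ) (λ ()) zero) λ ()
independent? {suc k} {suc n} w with all? (λ i → w i zero ≟ 0ℚ)
... | no ¬zeros with ¬∀⟶∃¬ _ _ (λ i → w i zero ≟ 0ℚ) ¬zeros
...   | p , pivot≢0 with independent? (Pivot.reduced w p pivot≢0)
...     | inj₁ (indep , k≤n) = inj₁ (Pivot.reduced⇒full w p pivot≢0 indep , s≤s k≤n)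
...     | inj₂ dep           = inj₂ (dep ∘ Pivot.full⇒reduced w p pivot≢0)
independent? {suc k} {suc n} w | yes zeros with independent? (λ i → w i ∘ suc)
...   | inj₁ (indep , k≤n) = inj₁ ((λ c cw≡0 → indep c (cw≡0 ∘ suc)) , ℕ.m≤n⇒m≤1+n k≤n)
...   | inj₂ dep           = inj₂ λ indep → dep λ c cw≡0 → indep c λ
  { zero    → sumℚ-zero λ i → trans (cong (c i *_) (zeros i)) (*-zeroʳ (c i))
  ; (suc j) → cw≡0 j }

independent⇒≤ : ∀ {k n} (w : Fin k → Fin n → ℚ) → Independent w → k ≤ n
independent⇒≤ w indep with independent? w
... | inj₁ (_ , k≤n) = k≤n
... | inj₂ dep       = contradiction indep dep

-- Sums of rank-one functions

-- Rank as the length of a sum of products p(x) q(y). The index types are arbitrary, so words serve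
-- directly as row and column labels; the equations are pointwise, which avoids extensionality.
data RankAtMost {X Y : Set} : ℕ → (X → Y → ℚ) → Set where
  null : ∀ {f} → (∀ x y → f x y ≡ 0ℚ) → RankAtMost 0 f
  step : ∀ {R f g} (p : X → ℚ) (q : Y → ℚ) → (∀ x y → f x y ≡ p x * q y + g x y) →
         RankAtMost R g → RankAtMost (suc R) f

module _ {X Y : Set} where

  rank-resp : ∀ {R} {f g : X → Y → ℚ} → (∀ x y → g x y ≡ f x y) → RankAtMost R f → RankAtMost R g
  rank-resp g≡f (null f≡0)      = null λ x y → trans (g≡f x y) (f≡0 x y)
  rank-resp g≡f (step p q eq r) = step p q (λ x y → trans (g≡f x y) (eq x y)) r

  rank-+ : ∀ {R S} {f g : X → Y → ℚ} → RankAtMost R f → RankAtMost S g →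
           RankAtMost (R ℕ.+ S) (λ x y → f x y + g x y)
  rank-+ {g = g} (null f≡0) s =
    rank-resp (λ x y → trans (cong (_+ g x y) (f≡0 x y)) (+-identityˡ (g x y))) s
  rank-+ {g = g} (step {g = f′} p q eq r) s =
    step p q (λ x y → trans (cong (_+ g x y) (eq x y)) (+-assoc (p x * q y) (f′ x y) (g x y))) (rank-+ r s)

  -- A product of two rank-one functions has rank one, p q · p′ q′ = (p p′)(q q′), so the number of
  -- terms stays the same.
  rank-scale : ∀ {R} {f : X → Y → ℚ} (p : X → ℚ) (q : Y → ℚ) → RankAtMost R f →
               RankAtMost R (λ x y → p x * q y * f x y)
  rank-scale p q (null f≡0)        = null λ x y → trans (cong (p x * q y *_) (f≡0 x y)) (*-zeroʳ (p x * q y))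
  rank-scale p q (step {g = g} p′ q′ eq r) = step (λ x → p x * p′ x) (λ y → q y * q′ y)
    (λ x y → trans (cong (p x * q y *_) (eq x y))
      (solve 5 (λ p q p′ q′ g → p :* q :* (p′ :* q′ :+ g) := p :* p′ :* (q :* q′) :+ p :* q :* g) refl
        (p x) (q y) (p′ x) (q′ y) (g x y)))
    (rank-scale p q r)
    where open +-*-Solver

  -- Expanding the entrywise product of the two sums gives one term for each pair of terms.
  rank-* : ∀ {R S} {f g : X → Y → ℚ} → RankAtMost R f → RankAtMost S g →
           RankAtMost (R ℕ.* S) (λ x y → f x y * g x y)
  rank-* {g = g} (null f≡0) s = null λ x y → trans (cong (_* g x y) (f≡0 x y)) (*-zeroˡ (g x y))
  rank-* {g = g} (step {g = f′} p q eq r) s = rank-resp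
    (λ x y → trans (cong (_* g x y) (eq x y)) (*-distribʳ-+ (g x y) (p x * q y) (f′ x y)))
    (rank-+ (rank-scale p q s) (rank-* r s))

  rank-∘ : ∀ {X′ Y′ : Set} {R} {f : X → Y → ℚ} (g : X′ → X) (h : Y′ → Y) → RankAtMost R f →
           RankAtMost R (λ x y → f (g x) (h y))
  rank-∘ g h (null f≡0)      = null λ x y → f≡0 (g x) (h y)
  rank-∘ g h (step p q eq r) = step (p ∘ g) (q ∘ h) (λ x y → eq (g x) (h y)) (rank-∘ g h r)

  rank-sum : ∀ R (p : X → Fin R → ℚ) (q : Fin R → Y → ℚ) →
             RankAtMost R (λ x y → sumℚ R (λ i → p x i * q i y))
  rank-sum zero    p q = null λ _ _ → refl
  rank-sum (suc R) p q = step (λ x → p x zero) (q zero) (λ _ _ → refl) (rank-sum R (λ x → p x ∘ suc) (q ∘ suc))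

  coefficients : ∀ {R} {f : X → Y → ℚ} → RankAtMost R f → X → Fin R → ℚ
  coefficients (step p q eq r) x zero    = p x
  coefficients (step p q eq r) x (suc i) = coefficients r x i

  -- Each row of f combines the R right factors with weights `coefficients r x`, so a relation among
  -- weight vectors passes to the rows. Independent rows thus give independent vectors in ℚ^R.
  coefficients-relation : ∀ {R k} {f : X → Y → ℚ} (r : RankAtMost R f) (ρ : Fin k → X) (c : Fin k → ℚ) →
    (∀ l → sumℚ k (λ i → c i * coefficients r (ρ i) l) ≡ 0ℚ) →
    ∀ y → sumℚ k (λ i → c i * f (ρ i) y) ≡ 0ℚ
  coefficients-relation (null f≡0) ρ c rel y =
    sumℚ-zero λ i → trans (cong (c i *_) (f≡0 (ρ i) y)) (*-zeroʳ (c i))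
  coefficients-relation {k = k} {f} (step {g = g} p q eq r) ρ c rel y = begin
    sumℚ k (λ i → c i * f (ρ i) y)
      ≡⟨ sumℚ-cong (λ i → trans (cong (c i *_) (eq (ρ i) y))
           (solve 4 (λ c p q g → c :* (p :* q :+ g) := c :* p :* q :+ c :* g) refl (c i) (p (ρ i)) (q y) (g (ρ i) y))) ⟩
    sumℚ k (λ i → c i * p (ρ i) * q y + c i * g (ρ i) y)
      ≡⟨ sumℚ-+ (λ i → c i * p (ρ i) * q y) (λ i → c i * g (ρ i) y) ⟩
    sumℚ k (λ i → c i * p (ρ i) * q y) + sumℚ k (λ i → c i * g (ρ i) y)
      ≡⟨ cong₂ _+_ (sumℚ-* (λ i → c i * p (ρ i)) (q y)) (coefficients-relation r ρ c (rel ∘ suc) y) ⟩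
    sumℚ k (λ i → c i * p (ρ i)) * q y + 0ℚ
      ≡⟨ cong (λ s → s * q y + 0ℚ) (rel zero) ⟩
    0ℚ * q y + 0ℚ
      ≡⟨ solve 1 (λ q → con 0ℚ :* q :+ con 0ℚ := con 0ℚ) refl (q y) ⟩
    0ℚ ∎
    where
    open ≡-Reasoning
    open +-*-Solver

sum-δ : ∀ {m} (f : Fin m → ℚ) x → sumℚ m (λ i → toℚ (does (x ≟F i)) * f i) ≡ f x
sum-δ {suc m} f x = begin
  sumℚ (suc m) (λ i → toℚ (does (x ≟F i)) * f i)
    ≡⟨ sumℚ-punchIn (λ i → toℚ (does (x ≟F i)) * f i) x ⟩
  toℚ (does (x ≟F x)) * f x + sumℚ m (λ i → toℚ (does (x ≟F punchIn x i)) * f (punchIn x i))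
    ≡⟨ cong₂ _+_
         (trans (cong (λ b → toℚ b * f x) (dec-true (x ≟F x) refl)) (*-identityˡ (f x)))
         (sumℚ-zero λ i → trans
           (cong (λ b → toℚ b * f (punchIn x i))
             (dec-false (x ≟F punchIn x i) (punchInᵢ≢i x i ∘ sym)))
           (*-zeroˡ (f (punchIn x i)))) ⟩
  f x + 0ℚ
    ≡⟨ +-identityʳ (f x) ⟩
  f x ∎
  where open ≡-Reasoning

-- Expansion along the rows: one term δ(x, i) · f(i, y) for each letter i. Order and equality of
-- letters both cost at most m.
rank-Fin : ∀ {m} {Y : Set} (f : Fin m → Y → ℚ) → RankAtMost m f
rank-Fin {m} f = rank-resp (λ x y → sym (sum-δ (λ i → f i y) x))
  (rank-sum m (λ x i → toℚ (does (x ≟F i))) f)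

-- Rank and fooling number as maxima of bounded decidable predicates

-- Candidates are tested downwards from N, so the first success is the largest; `p₀` ends the search
-- at 0.
maximum : ∀ {P : ℕ → Set} → Decidable P → P 0 → ∀ N → (∀ k → P k → k ≤ N) →
          ∃ λ r → P r × (∀ k → P k → k ≤ r)
maximum P? p₀ zero    bound = 0 , p₀ , bound
maximum P? p₀ (suc N) bound with P? (suc N)
... | yes p = suc N , p , bound
... | no ¬p = maximum P? p₀ N λ k pk → ℕ.s≤s⁻¹ (ℕ.≤∧≢⇒< (bound k pk) λ where refl → ¬p pk)

Searchable : Set → Set₁
Searchable A = ∀ {P : A → Set} → Decidable P → Dec (∃ P)

×-searchable : ∀ {A B} → Searchable A → Searchable B → Searchable (A × B)
×-searchable search-A search-B P? =
  map′ (λ (a , b , p) → (a , b) , p) (λ ((a , b) , p) → a , b , p)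
    (search-A λ a → search-B λ b → P? (a , b))

-- Functions are searched value by value. The predicate has to respect `≗`, since a function is only
-- pointwise equal to the one rebuilt from its head and tail.
search-functions : ∀ {A} → Searchable A → ∀ k {P : (Fin k → A) → Set} →
  (∀ {f g} → f ≗ g → P f → P g) → Decidable P → Dec (∃ P)
search-functions search-A zero    resp P? =
  map′ (λ p → _ , p) (λ (f , p) → resp (λ ()) p) (P? λ ())
search-functions search-A (suc k) resp P? =
  map′ (λ (a , f , p) → a ∷ f , p) (λ (f , p) → f zero , f ∘ suc , resp (uncons f) p)
    (search-A λ a → search-functions search-A k (λ f≗g → resp (∷-cong f≗g)) (λ f → P? (a ∷ f)))
  where
  uncons : ∀ {A : Set} {k} (f : Fin (suc k) → A) → f ≗ (f zero ∷ (f ∘ suc))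
  uncons f zero    = refl
  uncons f (suc i) = refl
  ∷-cong : ∀ {A : Set} {k} {a : A} {f g : Fin k → A} → f ≗ g → (a ∷ f) ≗ (a ∷ g)
  ∷-cong f≗g zero    = refl
  ∷-cong f≗g (suc i) = f≗g i

module _ {n} (M : Matrix n) where

  rows-resp : ∀ {k} {ρ σ : Fin k → Fin n} → ρ ≗ σ → RowsIndependent M ρ → RowsIndependent M σ
  rows-resp ρ≗σ indep c cσ≡0 = indep c λ j →
    trans (sumℚ-cong λ i → cong (λ x → c i * toℚ (M x j)) (ρ≗σ i)) (cσ≡0 j)

  rows? : ∀ {k} → Decidable (RowsIndependent {n} {k} M)
  rows? ρ with independent? (λ i j → toℚ (M (ρ i) j))
  ... | inj₁ (indep , _) = yes indep
  ... | inj₂ dep         = no dep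

  -- `IsRank` asks for an attained maximum, so it is computed: all choices of k rows are tested by
  -- elimination, and independence in n columns bounds k by n.
  rank-exists : ∃ (IsRank M)
  rank-exists = let r , p , max = maximum (λ k → search-functions any? k rows-resp rows?) ((λ ()) , λ _ _ ()) n
                                    (λ k (ρ , indep) → independent⇒≤ (λ i j → toℚ (M (ρ i) j)) indep)
                in r , p , λ k ρ indep → max k (ρ , indep)

  rank≤ : ∀ {R r} → RankAtMost R (λ i j → toℚ (M i j)) → IsRank M r → r ≤ R
  rank≤ rk ((ρ , indep) , _) = independent⇒≤ (λ i → coefficients rk (ρ i))
    λ c rel → indep c (coefficients-relation rk ρ c rel)

  fooling-resp : ∀ {k} {s t : Fin k → Fin n × Fin n} → s ≗ t → IsFoolingSet M s → IsFoolingSet M t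
  fooling-resp s≗t (inj , z , diag , off) =
    (λ {i} {j} ti≡tj → inj (trans (s≗t i) (trans ti≡tj (sym (s≗t j))))) , z ,
    (λ i → subst (λ x → M (proj₁ x) (proj₂ x) ≡ z) (s≗t i) (diag i)) ,
    (λ i j i≢j → subst₂ (λ x y → M (proj₁ x) (proj₂ y) ≢ z ⊎ M (proj₁ y) (proj₂ x) ≢ z) (s≗t i) (s≗t j) (off i j i≢j))

  fooling? : ∀ {k} → Decidable (IsFoolingSet {n} {k} M)
  fooling? s =
    map′ (λ inj {i} {j} → inj i j) (λ inj i j → inj {i} {j})
      (all? λ i → all? λ j → ≡-dec _≟F_ _≟F_ (s i) (s j) →-dec i ≟F j)
    ×-dec
    map′ (λ { (inj₁ p) → true , p ; (inj₂ p) → false , p }) (λ { (true , p) → inj₁ p ; (false , p) → inj₂ p })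
      (monochromatic? true ⊎-dec monochromatic? false)
    where
    entry = λ i j → M (proj₁ (s i)) (proj₂ (s j))
    monochromatic? : ∀ z → Dec ((∀ i → entry i i ≡ z) × (∀ i j → i ≢ j → entry i j ≢ z ⊎ entry j i ≢ z))
    monochromatic? z = all? (λ i → entry i i ≟B z) ×-dec
      all? λ i → all? λ j → ¬? (i ≟F j) →-dec (¬? (entry i j ≟B z) ⊎-dec ¬? (entry j i ≟B z))

  fool-exists : ∃ (IsFool M)
  fool-exists = let f , p , max = maximum (λ k → search-functions (×-searchable any? any?) k fooling-resp fooling?)
                                    ((λ ()) , (λ {}) , true , (λ ()) , λ ()) (n ℕ.* n)
                                    (λ k (s , fooling) → bound s (proj₁ fooling))
                in f , p , λ k s fooling → max k (s , fooling)
    where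
    bound : ∀ {k} (s : Fin k → Fin n × Fin n) → (∀ {i j} → s i ≡ s j → i ≡ j) → k ≤ n ℕ.* n
    bound s inj = injective⇒≤ {f = λ i → combine (proj₁ (s i)) (proj₂ (s i))} λ {i} {j} eq →
      let eq₁ , eq₂ = combine-injective (proj₁ (s i)) (proj₂ (s i)) (proj₁ (s j)) (proj₂ (s j)) eq in inj (cong₂ _,_ eq₁ eq₂)

-- The fooling matrices

Word : ℕ → ℕ → Set
Word m zero    = Fin m
Word m (suc k) = Fin m × Fin m × Word m k

select : Bool → Bool → Bool → Bool
select A B C = if A then B ∧ C else not B ∧ not C

fools : ∀ {m} k → Word m k → Word m k → Bool
fools zero    c           c′             = does (c ≟F c′)
fools (suc k) (a , b , c) (a′ , b′ , c′) =
  select (does (a ≤?F a′)) (does (b ≟F b′)) (fools k c c′)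

fools-refl : ∀ {m} k (u : Word m k) → fools k u u ≡ true
fools-refl zero    c           = dec-true (c ≟F c) refl
fools-refl (suc k) (a , b , c)
  rewrite dec-true (a ≤?F a) ≤F-refl | dec-true (b ≟F b) refl = fools-refl k c

fools-antisym : ∀ {m} k (u v : Word m k) → fools k u v ≡ true → fools k v u ≡ true → u ≡ v
fools-antisym zero    c c′ uv vu with c ≟F c′
... | yes c≡c′ = c≡c′
-- The four decisions are passed as arguments so that `select` evaluates on them; patterns that turn
-- a hypothesis into `false ≡ true` disappear.
fools-antisym {m} (suc k) (a , b , c) (a′ , b′ , c′) = compare (a ≤?F a′) (a′ ≤?F a) (b ≟F b′) (b′ ≟F b)
  where
  compare : (a≤a′ : Dec (a Fin.≤ a′)) (a′≤a : Dec (a′ Fin.≤ a)) (b≡b′ : Dec (b ≡ b′)) (b′≡b : Dec (b′ ≡ b)) →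
    select (does a≤a′) (does b≡b′) (fools k c c′) ≡ true →
    select (does a′≤a) (does b′≡b) (fools k c′ c) ≡ true →
    _≡_ {A = Word m (suc k)} (a , b , c) (a′ , b′ , c′)
  compare (yes a≤a′) (yes a′≤a) (yes b≡b′) (yes _) uv vu =
    cong₂ _,_ (≤F-antisym a≤a′ a′≤a) (cong₂ _,_ b≡b′ (fools-antisym k c c′ uv vu))
  -- When a and a′ are strictly ordered, one hypothesis forces b = b′ and the other b ≠ b′.
  compare (yes _)    (no _)     (yes b≡b′) (no b′≢b)  _ _ = contradiction (sym b≡b′) b′≢b
  compare (no _)     (yes _)    (no b≢b′)  (yes b′≡b) _ _ = contradiction (sym b′≡b) b≢b′
  compare (no a≰a′)  (no a′≰a)  _          _          _ _ with ≤F-total a a′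
  ... | inj₁ a≤a′ = contradiction a≤a′ a≰a′
  ... | inj₂ a′≤a = contradiction a′≤a a′≰a

-- One summand for each of the three products in `multilinear`: B C, (1 - A) C and (1 - A)(1 - B).
rankBound : ℕ → ℕ → ℕ
rankBound m zero    = m
rankBound m (suc k) = m ℕ.* rankBound m k ℕ.+ (m ℕ.* rankBound m k ℕ.+ m ℕ.* m)

-- No term involves all three of A, B, C: two new coordinates cost only one factor m in the rank.
multilinear : ∀ A B C → toℚ (select A B C)
              ≡ toℚ B * toℚ C + ((- toℚ (not A)) * toℚ C + toℚ (not A) * toℚ (not B))
multilinear true  true  true  = refl
multilinear true  true  false = refl
multilinear true  false true  = refl
multilinear true  false false = refl
multilinear false true  true  = refl
multilinear false true  false = refl
multilinear false false true  = refl
multilinear false false false = refl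

rank-fools : ∀ m k → RankAtMost (rankBound m k) (λ u v → toℚ (fools {m} k u v))
rank-fools m zero    = rank-Fin _
rank-fools m (suc k) = rank-resp
  (λ (a , b , c) (a′ , b′ , c′) → multilinear (does (a ≤?F a′)) (does (b ≟F b′)) (fools k c c′))
  (rank-+ (rank-* (on-b (λ b b′ → toℚ (does (b ≟F b′)))) on-c)
    (rank-+ (rank-* (on-a (λ a a′ → - toℚ (not (does (a ≤?F a′))))) on-c)
      (rank-* (on-a (λ a a′ → toℚ (not (does (a ≤?F a′))))) (on-b (λ b b′ → toℚ (not (does (b ≟F b′))))))))
  where
  on-a : ∀ (h : Fin m → Fin m → ℚ) → RankAtMost m (λ (u v : Word m (suc k)) → h (proj₁ u) (proj₁ v))
  on-a h = rank-∘ proj₁ proj₁ (rank-Fin h)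
  on-b : ∀ (h : Fin m → Fin m → ℚ) → RankAtMost m (λ (u v : Word m (suc k)) → h (proj₁ (proj₂ u)) (proj₁ (proj₂ v)))
  on-b h = rank-∘ (proj₁ ∘ proj₂) (proj₁ ∘ proj₂) (rank-Fin h)
  on-c : RankAtMost (rankBound m k) (λ (u v : Word m (suc k)) → toℚ (fools k (proj₂ (proj₂ u)) (proj₂ (proj₂ v))))
  on-c = rank-∘ (proj₂ ∘ proj₂) (proj₂ ∘ proj₂) (rank-fools m k)

-- The count m^(2k+1), nested exactly as `Word` is, so that `*↔×` applies at each level.
size : ℕ → ℕ → ℕ
size m zero    = m
size m (suc k) = m ℕ.* (m ℕ.* size m k)

Fin↔Word : ∀ m k → Fin (size m k) ↔ Word m k
Fin↔Word m zero    = ↔-refl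
Fin↔Word m (suc k) = ↔-trans *↔× (↔-refl ×-↔ ↔-trans *↔× (↔-refl ×-↔ Fin↔Word m k))

module Construction (m k : ℕ) where

  open Inverse (Fin↔Word m k)

  matrix : Matrix (size m k)
  matrix i j = fools k (to i) (to j)

  rank-upper : ∀ {r} → IsRank matrix r → r ≤ rankBound m k
  rank-upper = rank≤ matrix (rank-∘ to to (rank-fools m k))

  to-injective : ∀ {i j} → to i ≡ to j → i ≡ j
  to-injective {i} {j} eq = trans (sym (strictlyInverseʳ i)) (trans (cong from eq) (strictlyInverseʳ j))

  fool-lower : ∀ {f} → IsFool matrix f → size m k ≤ f
  fool-lower (_ , max) = max _ (λ i → i , i) (cong proj₁ , true , (λ i → fools-refl k (to i)) , off)
    where
    off : ∀ i j → i ≢ j → matrix i j ≢ true ⊎ matrix j i ≢ true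
    off i j i≢j with matrix i j in ij | matrix j i in ji
    ... | false | _     = inj₁ λ ()
    ... | true  | false = inj₂ λ ()
    ... | true  | true  = contradiction (to-injective (fools-antisym k (to i) (to j) ij ji)) i≢j

-- Words differing only in one b-coordinate index an identity submatrix.
rank-lower : ∀ m k {r} → IsRank (Construction.matrix (suc m) (suc k)) r → suc m ≤ r
rank-lower m k (_ , max) = max (suc m) row λ c c-rel i → begin
  c i
    ≡⟨ sum-δ c i ⟨
  sumℚ (suc m) (λ j → toℚ (does (i ≟F j)) * c j)
    ≡⟨ sumℚ-cong (λ j → trans (solve 2 (λ x y → x :* y := y :* x) refl (toℚ (does (i ≟F j))) (c j)) (cong (λ b → c j * toℚ b) (sym (entry j i)))) ⟩
  sumℚ (suc m) (λ j → c j * toℚ (matrix (row j) (row i)))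
    ≡⟨ c-rel (row i) ⟩
  0ℚ ∎
  where
  open ≡-Reasoning
  open +-*-Solver
  open Construction (suc m) (suc k) using (matrix)
  open Inverse (Fin↔Word (suc m) (suc k))
  constant : ∀ k → Word (suc m) k
  constant zero    = zero
  constant (suc k) = zero , zero , constant k
  word : Fin (suc m) → Word (suc m) (suc k)
  word b = zero , b , constant k
  row : Fin (suc m) → Fin (size (suc m) (suc k))
  row b = from (word b)
  -- Equal first letters put `select` in the branch B ∧ C, and C is true on the shared tail; only
  -- the comparison of b and b′ survives.
  fools-word : ∀ b b′ → fools (suc k) (word b) (word b′) ≡ does (b′ ≟F b)
  fools-word b b′ rewrite fools-refl k (constant k) with b ≟F b′
  ... | yes refl = sym (dec-true (b ≟F b) refl)
  ... | no  b≢b′ = sym (dec-false (b′ ≟F b) (b≢b′ ∘ sym))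
  entry : ∀ b b′ → matrix (row b) (row b′) ≡ does (b′ ≟F b)
  entry b b′ = trans (cong₂ (fools (suc k)) (strictlyInverseˡ (word b)) (strictlyInverseˡ (word b′))) (fools-word b b′)

-- Choice of parameters

-- The right side is 3^k m^(k+1) for m = 3^e. Each of the three summands in the recursion is at most
-- m P, and their number 3 is one more power of the base.
rankBound-3^ : ∀ e k → rankBound (3 ℕ.^ e) k ≤ 3 ℕ.^ (k ℕ.+ e ℕ.* suc k)
rankBound-3^ e zero    = ℕ.≤-reflexive (cong (3 ℕ.^_) (sym (ℕ.*-identityʳ e)))
rankBound-3^ e (suc k) = begin
  m ℕ.* R ℕ.+ (m ℕ.* R ℕ.+ m ℕ.* m)
    ≤⟨ ℕ.+-mono-≤ (ℕ.*-monoʳ-≤ m ih) (ℕ.+-mono-≤ (ℕ.*-monoʳ-≤ m ih) (ℕ.*-monoʳ-≤ m m≤P)) ⟩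
  m ℕ.* P ℕ.+ (m ℕ.* P ℕ.+ m ℕ.* P)
    ≡⟨ cong (λ x → m ℕ.* P ℕ.+ (m ℕ.* P ℕ.+ x)) (sym (ℕ.+-identityʳ _)) ⟩
  3 ℕ.* (m ℕ.* P)
    ≡⟨ cong (3 ℕ.*_) (sym (ℕ.^-distribˡ-+-* 3 e (k ℕ.+ e ℕ.* suc k))) ⟩
  3 ℕ.^ suc (e ℕ.+ (k ℕ.+ e ℕ.* suc k))
    ≡⟨ cong (3 ℕ.^_) (solve 2 (λ e k → con 1 :+ (e :+ (k :+ e :* (con 1 :+ k))) := con 1 :+ k :+ e :* (con 2 :+ k)) refl e k) ⟩
  3 ℕ.^ (suc k ℕ.+ e ℕ.* suc (suc k)) ∎
  where
  open ℕ.≤-Reasoning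
  open ℕSolver.+-*-Solver
  m = 3 ℕ.^ e
  R = rankBound m k
  P = 3 ℕ.^ (k ℕ.+ e ℕ.* suc k)
  ih : R ≤ P
  ih = rankBound-3^ e k
  m≤P : m ≤ P
  m≤P = ℕ.^-monoʳ-≤ 3 (ℕ.≤-trans (ℕ.m≤m*n e (suc k)) (ℕ.m≤n+m _ k))

size-3^ : ∀ e k → size (3 ℕ.^ e) k ≡ 3 ℕ.^ (e ℕ.* suc (2 ℕ.* k))
size-3^ e zero    = cong (3 ℕ.^_) (sym (ℕ.*-identityʳ e))
size-3^ e (suc k) = begin
  m ℕ.* (m ℕ.* size m k)                        ≡⟨ cong (λ x → m ℕ.* (m ℕ.* x)) (size-3^ e k) ⟩
  m ℕ.* (m ℕ.* 3 ℕ.^ (e ℕ.* suc (2 ℕ.* k)))     ≡⟨ cong (m ℕ.*_) (sym (ℕ.^-distribˡ-+-* 3 e _)) ⟩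
  m ℕ.* 3 ℕ.^ (e ℕ.+ e ℕ.* suc (2 ℕ.* k))       ≡⟨ sym (ℕ.^-distribˡ-+-* 3 e _) ⟩
  3 ℕ.^ (e ℕ.+ (e ℕ.+ e ℕ.* suc (2 ℕ.* k)))     ≡⟨ cong (3 ℕ.^_) (solve 2 (λ e k → e :+ (e :+ e :* (con 1 :+ con 2 :* k)) := e :* (con 1 :+ con 2 :* (con 1 :+ k))) refl e k) ⟩
  3 ℕ.^ (e ℕ.* suc (2 ℕ.* suc k))               ∎
  where
  open ≡-Reasoning
  open ℕSolver.+-*-Solver
  m = 3 ℕ.^ e

-- With these parameters rank ≤ 3 ^ (3k(t+1)) and n = 3 ^ (3k(2t+1)) for k = depth t.
depth : ℕ → ℕ
depth t = suc (3 ℕ.* t)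

alphabet : ℕ → ℕ
alphabet t = 3 ℕ.^ depth t

-- This is r^((2t+1)/(t+1)) ≤ f with the denominator of the exponent cleared.
power-inequality : ∀ t {r f} → r ≤ rankBound (alphabet t) (depth t) → size (alphabet t) (depth t) ≤ f →
                   r ℕ.^ suc (2 ℕ.* t) ≤ f ℕ.^ suc t
power-inequality t {r} {f} r≤ ≤f = begin
  r ℕ.^ suc (2 ℕ.* t)
    ≤⟨ ℕ.^-monoˡ-≤ (suc (2 ℕ.* t)) (ℕ.≤-trans r≤ (rankBound-3^ k k)) ⟩
  (3 ℕ.^ (k ℕ.+ k ℕ.* suc k)) ℕ.^ suc (2 ℕ.* t)
    ≡⟨ ℕ.^-*-assoc 3 (k ℕ.+ k ℕ.* suc k) (suc (2 ℕ.* t)) ⟩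
  3 ℕ.^ ((k ℕ.+ k ℕ.* suc k) ℕ.* suc (2 ℕ.* t))
    -- The choice k = 3t + 1 makes k + 2 = 3(t + 1) and 2k + 1 = 3(2t + 1), so both exponents equal
    -- 3k(t + 1)(2t + 1).
    ≡⟨ cong (3 ℕ.^_) (solve 1 (λ t → let k = con 1 :+ con 3 :* t in
         (k :+ k :* (con 1 :+ k)) :* (con 1 :+ con 2 :* t) := k :* (con 1 :+ con 2 :* k) :* (con 1 :+ t)) refl t) ⟩
  3 ℕ.^ (k ℕ.* suc (2 ℕ.* k) ℕ.* suc t)
    ≡⟨ ℕ.^-*-assoc 3 (k ℕ.* suc (2 ℕ.* k)) (suc t) ⟨
  (3 ℕ.^ (k ℕ.* suc (2 ℕ.* k))) ℕ.^ suc t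
    ≤⟨ ℕ.^-monoˡ-≤ (suc t) (ℕ.≤-trans (ℕ.≤-reflexive (sym (size-3^ k k))) ≤f) ⟩
  f ℕ.^ suc t ∎
  where
  open ℕ.≤-Reasoning
  open ℕSolver.+-*-Solver
  k = depth t

-- Growth of the rank

n<3^n : ∀ n → n ℕ.< 3 ℕ.^ n
n<3^n zero    = s≤s z≤n
n<3^n (suc n) = begin
  2 ℕ.+ n                              ≡⟨ ℕ.+-comm 1 (suc n) ⟩
  suc n ℕ.+ 1                          ≤⟨ ℕ.+-mono-≤ (n<3^n n) (ℕ.m^n>0 3 n) ⟩
  3 ℕ.^ n ℕ.+ 3 ℕ.^ n                  ≤⟨ ℕ.+-monoʳ-≤ (3 ℕ.^ n) (ℕ.m≤m+n _ _) ⟩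
  3 ℕ.^ suc n                          ∎
  where open ℕ.≤-Reasoning

-- The alphabet has more than `depth t` letters, and the rank is at least the number of letters.
rank-grows : ∀ t {r} → IsRank (Construction.matrix (alphabet t) (depth t)) r → t ≤ r
rank-grows t {r} isRank with alphabet t | n<3^n (depth t)
... | suc m | s≤s d≤m = begin
  t        ≤⟨ ℕ.m≤n*m t 3 ⟩
  3 ℕ.* t  ≤⟨ ℕ.n≤1+n _ ⟩
  depth t  ≤⟨ d≤m ⟩
  m        ≤⟨ ℕ.n≤1+n m ⟩
  suc m    ≤⟨ rank-lower m (3 ℕ.* t) isRank ⟩
  r        ∎
  where open ℕ.≤-Reasoning

-- The exponent 2 - 1/(t + 1)

epsilon : ℕ → ℚ
epsilon t = mkℚ (ℤ.+ 1) t (1-coprimeTo (suc t))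

-- Given in lowest terms by `mkℚ`, so that numerator and denominator are visible and `PowLe` reduces
-- to an inequality between natural powers.
exponent : ℕ → ℚ
exponent t = mkℚ (ℤ.+ suc (2 ℕ.* t)) t coprime
  where
  coprime : Coprime (suc (2 ℕ.* t)) (suc t)
  -- A common divisor of 2t + 1 and t + 1 divides 2(t + 1) - (2t + 1) = 1.
  coprime {d} (d∣1+2t , d∣1+t) = ∣1⇒≡1 (∣m+n∣m⇒∣n (subst (d ∣_) eq (∣n⇒∣m*n 2 d∣1+t)) d∣1+2t)
    where
    open ℕSolver.+-*-Solver
    eq : 2 ℕ.* suc t ≡ suc (2 ℕ.* t) ℕ.+ 1
    eq = solve 1 (λ t → con 2 :* (con 1 :+ t) := con 1 :+ con 2 :* t :+ con 1) refl t

exponent+epsilon : ∀ t → exponent t + epsilon t ≡ 2ℚ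
exponent+epsilon t = toℚᵘ-injective (ℚᵘ.≃-trans (toℚᵘ-homo-+ (exponent t) (epsilon t)) (*≡* eq))
  where
  open ℕSolver.+-*-Solver
  eq : (ℤ.+ suc (2 ℕ.* t) ℤ.* ℤ.+ suc t ℤ.+ ℤ.+ 1 ℤ.* ℤ.+ suc t) ℤ.* ℤ.+ 1 ≡ ℤ.+ 2 ℤ.* (ℤ.+ (suc t ℕ.* suc t))
  eq = cong ℤ.+_ (solve 1 (λ t → ((con 1 :+ con 2 :* t) :* (con 1 :+ t) :+ con 1 :* (con 1 :+ t)) :* con 1 := con 2 :* ((con 1 :+ t) :* (con 1 :+ t))) refl t)

2-epsilon : ∀ t → 2ℚ - epsilon t ≡ exponent t
2-epsilon t = trans (cong (_- epsilon t) (sym (exponent+epsilon t)))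
  (solve 2 (λ x y → x :+ y :- y := x) refl (exponent t) (epsilon t))
  where open +-*-Solver

epsilon-tends : TendsToZero epsilon
epsilon-tends (mkℚ (ℤ.+ zero) q _)    (*<* (ℤ.+<+ ()))
-- For δ = (p + 1)/(q + 1) the threshold q + 1 suffices, as 1/(t + 1) < 1/(q + 1) ≤ δ.
epsilon-tends (mkℚ (ℤ.+ suc p) q _)   _ = suc q , λ t q<t → *<* (ℤ.+<+ (ℕ.≤-trans (s≤s (ℕ.≤-reflexive (ℕ.*-identityˡ (suc q)))) (ℕ.≤-trans (s≤s q<t) (ℕ.m≤n*m (suc t) (suc p)))))
epsilon-tends (mkℚ (ℤ.-[1+ p ]) q _) (*<* ())

theorem2 : Σ (ℕ → ℕ) λ n → Σ ((t : ℕ) → Matrix (n t)) λ M →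
    Σ (ℕ → ℕ) λ rk → Σ (ℕ → ℕ) λ fl → Σ (ℕ → ℚ) λ ε →
    ((t : ℕ) → IsRank (M t) (rk t)) ×
    ((t : ℕ) → IsFool (M t) (fl t)) ×
    TendsToInfinity rk ×
    TendsToZero ε ×
    ((t : ℕ) → PowLe (rk t) (2ℚ - ε t) (fl t))
theorem2 =
  _ , M , rk , fl , epsilon , isRank , isFool ,
  -- The rank of the matrix at t is at least t, so B itself is a threshold.
  (λ B → B , λ t B≤t → ℕ.≤-trans B≤t (rank-grows t (isRank t))) ,
  epsilon-tends ,
  -- Replacing 2 - ε by `exponent` lets `PowLe` compute.
  λ t → subst (λ e → PowLe (rk t) e (fl t)) (sym (2-epsilon t))
    (power-inequality t (Construction.rank-upper (alphabet t) (depth t) (isRank t))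
                        (Construction.fool-lower (alphabet t) (depth t) (isFool t)))
  where
  M : ∀ t → Matrix (size (alphabet t) (depth t))
  M t = Construction.matrix (alphabet t) (depth t)
  rk fl : ℕ → ℕ
  rk t = proj₁ (rank-exists (M t))
  fl t = proj₁ (fool-exists (M t))
  isRank : ∀ t → IsRank (M t) (rk t)
  isRank t = proj₂ (rank-exists (M t))
  isFool : ∀ t → IsFool (M t) (fl t)
  isFool t = proj₂ (fool-exists (M t))
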